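{- Let $k\ge 1$ be an integer and let $G$ be a connected chordal graph. Then $G$ is a $k$-tree if and only if the reduced clique graph $C_r(G)$ and the $(k+1)$-line graph $\ell_{k+1}(G)$ are the same graph (same vertex set and same edge set).
   Context: All graphs are finite and simple. A $k$-tree is defined recursively: the complete graph on $k+1$ vertices is a $k$-tree, and a $k$-tree with $n+1$ vertices ($n\ge k+1$) is obtained from a $k$-tree with $n$ vertices by adding a new vertex adjacent exactly to the vertices of some $k$-clique of it. For maximal cliques $Q,Q'$ of a chordal graph $G$, they form a separating pair if $Q\cap Q'\neq\emptyset$ and every path in $G$ from a vertex of $Q\setminus Q'$ to a vertex of $Q'\setminus Q$ contains a vertex of $Q\cap Q'$. The reduced clique graph $C_r(G)$ is the graph whose vertices are the maximal cliques of $G$ (as vertex subsets) and whose edges join pairs of maximal cliques forming separating pairs. For an integer $j\ge 2$, the $j$-line graph $\ell_j(G)$ is the graph whose vertices are the $j$-cliques of $G$ (vertex subsets of size $j$ inducing complete graphs), two being adjacent iff they share exactly $j-1$ vertices. -}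

module Defs where

open import Data.Nat using (ℕ; zero; suc; _≤_; _∸_)
open import Data.Bool using (Bool; true; false; not; T)
open import Data.Fin using (Fin; zero; suc; toℕ; _≟_)
open import Data.Fin.Subset using (Subset; _∈_; _∉_; _⊆_; _∩_; ∣_∣; Nonempty)
open import Data.Vec using (lookup)
open import Data.List using (List; []; _∷_)
open import Data.List.Relation.Unary.Any using (Any)
open import Data.List.Relation.Unary.Unique.Propositional using (Unique)
open import Data.Product using (Σ; ∃; _×_)
open import Data.Sum using (_⊎_)
open import Relation.Nullary using (¬_)
open import Relation.Nullary.Decidable using (⌊_⌋)
open import Relation.Binary.PropositionalEquality using (_≡_; _≢_)
open import Function.Bundles using (_⇔_; _↔_; Inverse)

Rel : ℕ → Set
Rel n = Fin n → Fin n → Bool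

record Graph : Set where
  field
    n      : ℕ
    E      : Rel n
    sym    : ∀ i j → E i j ≡ E j i
    irrefl : ∀ i → E i i ≡ false
open Graph public

IsCliqueR : ∀ {n} → Rel n → Subset n → Set
IsCliqueR E S = ∀ i j → i ∈ S → j ∈ S → i ≢ j → T (E i j)

complete : ∀ m → Rel m
complete m i j = not ⌊ i ≟ j ⌋

extend : ∀ {n} → Rel n → Subset n → Rel (suc n)
extend E C zero    zero    = false
extend E C zero    (suc j) = lookup C j
extend E C (suc i) zero    = lookup C i
extend E C (suc i) (suc j) = E i j

data KTreeR (k : ℕ) : (n : ℕ) → Rel n → Set where
  base : KTreeR k (suc k) (complete (suc k))
  step : ∀ {n E} → KTreeR k n E → (C : Subset n) →
         IsCliqueR E C → ∣ C ∣ ≡ k → KTreeR k (suc n) (extend E C)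

IsKTree : ℕ → Graph → Set
IsKTree k G = Σ (Rel (n G)) λ E' → KTreeR k (n G) E' ×
  Σ (Fin (n G) ↔ Fin (n G)) λ σ →
    ∀ i j → E G i j ≡ E' (Inverse.to σ i) (Inverse.to σ j)

Adj : (G : Graph) → Fin (n G) → Fin (n G) → Set
Adj G i j = T (E G i j)

data Walk (G : Graph) : Fin (n G) → Fin (n G) → Set where
  [] : ∀ {a} → Walk G a a
  _∷_ : ∀ {a b c} → Adj G a b → Walk G b c → Walk G a c

verts : ∀ {G a b} → Walk G a b → List (Fin (n G))
verts {a = a} []      = a ∷ []
verts {a = a} (_ ∷ w) = a ∷ verts w

IsPath : ∀ {G a b} → Walk G a b → Set
IsPath w = Unique (verts w)

Connected : Graph → Set
Connected G = ∀ a b → Walk G a b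

-- Chordality: every cycle of length ≥ 4 has a chord.
-- A cycle of length suc m is an injective c : Fin (suc m) → Fin n with
-- c i adjacent to c (i+1 mod (suc m)).

Consec : ∀ m → Fin (suc m) → Fin (suc m) → Set
Consec m i j = toℕ j ≡ suc (toℕ i) ⊎ (toℕ i ≡ m × toℕ j ≡ 0)

IsCycle : (G : Graph) → ∀ m → (Fin (suc m) → Fin (n G)) → Set
IsCycle G m c = (∀ i j → c i ≡ c j → i ≡ j) × (∀ i j → Consec m i j → Adj G (c i) (c j))

HasChord : (G : Graph) → ∀ m → (Fin (suc m) → Fin (n G)) → Set
HasChord G m c = ∃ λ i → ∃ λ j → i ≢ j × ¬ Consec m i j × ¬ Consec m j i × Adj G (c i) (c j)

Chordal : Graph → Set
Chordal G = ∀ m → 3 ≤ m → (c : Fin (suc m) → Fin (n G)) → IsCycle G m c → HasChord G m c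

IsClique : (G : Graph) → Subset (n G) → Set
IsClique G = IsCliqueR (E G)

IsMaximalClique : (G : Graph) → Subset (n G) → Set
IsMaximalClique G Q = IsClique G Q × (∀ T → IsClique G T → Q ⊆ T → T ⊆ Q)

IsSeparatingPair : (G : Graph) → Subset (n G) → Subset (n G) → Set
IsSeparatingPair G Q Q' = Nonempty (Q ∩ Q') ×
  (∀ a b → a ∈ Q → a ∉ Q' → b ∈ Q' → b ∉ Q →
     (p : Walk G a b) → IsPath p → Any (λ v → v ∈ (Q ∩ Q')) (verts p))

CrVertex : (G : Graph) → Subset (n G) → Set
CrVertex = IsMaximalClique

CrEdge : (G : Graph) → Subset (n G) → Subset (n G) → Set
CrEdge G Q Q' = CrVertex G Q × CrVertex G Q' × Q ≢ Q' × IsSeparatingPair G Q Q'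

LineVertex : ℕ → (G : Graph) → Subset (n G) → Set
LineVertex j G S = IsClique G S × ∣ S ∣ ≡ j

LineEdge : ℕ → (G : Graph) → Subset (n G) → Subset (n G) → Set
LineEdge j G S S' = LineVertex j G S × LineVertex j G S' × ∣ S ∩ S' ∣ ≡ j ∸ 1

CrEqualsLine : ℕ → Graph → Set
CrEqualsLine j G =
  (∀ S → CrVertex G S ⇔ LineVertex j G S) ×
  (∀ S S' → CrEdge G S S' ⇔ LineEdge j G S S')

{-# OPTIONS --safe #-}

-- A k-tree is a graph that can be dismantled by repeatedly deleting a vertex v whose neighbourhood
-- in the remaining set U is a k-clique, until a (k+1)-clique is left. Walks bypass such a v inside
-- its neighbourhood, so separation in U and in U - v agree for cliques avoiding v, while the only
-- (k+1)-clique through v is its closed neighbourhood Q; this gives one direction by induction.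
-- Conversely, a chordal graph has a simplicial vertex v, and Q then has k+1 elements. Among the other
-- maximal cliques meeting Q, one with the largest intersection with Q forms a separating pair with Q
-- (otherwise chordality yields a larger intersection), so it shares k vertices with Q and contains
-- N(v). Hence N(v) stays extensible to a (k+1)-clique after v is deleted, and the hypotheses survive.
-- For the simplicial vertex, take a maximal connected X whose closed neighbourhood is not everything:
-- the boundary of X is a clique joined completely to the rest B, so a vertex simplicial in B will do.
module Submission where

open import Defs
open import Data.Nat using (ℕ; zero; suc; _≤_; _<_; _∸_; z≤n; s≤s)
open import Data.Nat.Properties using (≤-trans; ≤-antisym; ≤-reflexive; <-irrefl; <-cmp; suc-injective; m≤n⇒m<n∨m≡n; ∸-monoʳ-<; n<1+n)
open import Data.Nat.Induction using (<-wellFounded)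
open import Data.Bool using (T)
open import Data.Bool.Properties using (T?; T-≡)
open import Data.Empty using (⊥-elim) renaming (⊥ to Empty)
open import Data.Fin using (Fin; zero; suc; toℕ; fromℕ; _≟_)
open import Data.Fin.Properties using (toℕ-fromℕ; any?; toℕ-injective) renaming (suc-injective to Fin-suc-injective)
open import Data.Fin.Subset using (Subset; inside; outside; ⊤; ⊥; ⁅_⁆; _∈_; _∉_; _⊆_; _⊂_; _∩_; _∪_; _─_; _-_; ∣_∣; Nonempty)
open import Data.Fin.Subset.Properties
open import Data.List using (List; []; _∷_; length; lookup)
open import Data.List.Relation.Unary.All using (All; []; _∷_)
import Data.List.Relation.Unary.All as All
open import Data.List.Relation.Unary.All.Properties using (¬Any⇒All¬; All¬⇒¬Any)
import Data.List.Relation.Unary.Any as Any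
open import Data.List.Relation.Unary.AllPairs using ([]; _∷_)
open import Data.List.Relation.Unary.Unique.Propositional using (Unique)
open import Data.List.Membership.Propositional.Properties using (∈-lookup)
open import Data.Product using (Σ; ∃; ∃₂; _×_; _,_; proj₁; proj₂)
open import Data.Sum using (_⊎_; inj₁; inj₂; [_,_]′)
open import Data.Vec using ([]; _∷_; tabulate; here; there)
import Data.Vec as Vec
open import Data.Vec.Properties using ([]=⇒lookup; lookup⇒[]=; lookup∘tabulate)
open import Function using (_∘_; id; case_of_)
open import Function.Bundles using (_⇔_; mk⇔; mk↔ₛ′; Equivalence; Inverse)
open import Induction.WellFounded using (Acc; acc)
open import Relation.Binary using (tri<; tri≈; tri>)
open import Relation.Binary.PropositionalEquality using (_≡_; _≢_; refl; trans; cong; cong₂; subst; subst₂) renaming (sym to ≡-sym)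
open import Relation.Nullary using (¬_; Dec; yes; no; does)
open import Relation.Nullary.Decidable using (_×-dec_; ¬?; decidable-stable; dec-true)

-- Finite subsets

x∈p─q⇒x∉q : ∀ {m} {p q : Subset m} {x} → x ∈ p ─ q → x ∉ q
x∈p─q⇒x∉q {p = _ ∷ _} {outside ∷ _} here ()
x∈p─q⇒x∉q {p = _ ∷ _} {_ ∷ _} (there x∈) (there x∈q) = x∈p─q⇒x∉q x∈ x∈q

module _ {m : ℕ} where

  x∈p-y⇒x∈p : ∀ {p : Subset m} {x y} → x ∈ p - y → x ∈ p
  x∈p-y⇒x∈p {p} {y = y} = p─q⊆p p ⁅ y ⁆

  x∈p-y⇒x≢y : ∀ {p : Subset m} {x y} → x ∈ p - y → x ≢ y
  x∈p-y⇒x≢y x∈ refl = x∈p─q⇒x∉q x∈ (x∈⁅x⁆ _)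

  p⊆p∪⁅x⁆ : ∀ {p : Subset m} {x} → p ⊆ p ∪ ⁅ x ⁆
  p⊆p∪⁅x⁆ {x = x} = p⊆p∪q ⁅ x ⁆

  x∈p∪⁅x⁆ : ∀ {p : Subset m} {x} → x ∈ p ∪ ⁅ x ⁆
  x∈p∪⁅x⁆ {p} {x} = q⊆p∪q p ⁅ x ⁆ (x∈⁅x⁆ x)

  x∈p∪⁅y⁆⁻ : ∀ {p : Subset m} {x y} → x ∈ p ∪ ⁅ y ⁆ → x ∈ p ⊎ x ≡ y
  x∈p∪⁅y⁆⁻ {p} {y = y} x∈ with x∈p∪q⁻ p ⁅ y ⁆ x∈
  ... | inj₁ x∈p = inj₁ x∈p
  ... | inj₂ x∈y = inj₂ (x∈⁅y⁆⇒x≡y y x∈y)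

  ∪⁅⁆-⊆ : ∀ {p q : Subset m} {x} → p ⊆ q → x ∈ q → p ∪ ⁅ x ⁆ ⊆ q
  ∪⁅⁆-⊆ p⊆q x∈q y∈ with x∈p∪⁅y⁆⁻ y∈
  ... | inj₁ y∈p = p⊆q y∈p
  ... | inj₂ refl = x∈q

  ∈∩ : ∀ {p q : Subset m} {x} → x ∈ p → x ∈ q → x ∈ p ∩ q
  ∈∩ x∈p x∈q = x∈p∩q⁺ (x∈p , x∈q)

  ∈∩ˡ : ∀ {p q : Subset m} {x} → x ∈ p ∩ q → x ∈ p
  ∈∩ˡ {p} {q} = p∩q⊆p p q

  ∈∩ʳ : ∀ {p q : Subset m} {x} → x ∈ p ∩ q → x ∈ q
  ∈∩ʳ {p} {q} = p∩q⊆q p q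

  ⊈⇒∃ : ∀ (p q : Subset m) → ¬ p ⊆ q → ∃ λ x → x ∈ p × x ∉ q
  ⊈⇒∃ p q p⊈q with any? (λ x → x ∈? p ×-dec ¬? (x ∈? q))
  ... | yes found = found
  ... | no none = ⊥-elim (p⊈q λ {x} x∈p → decidable-stable (x ∈? q) λ x∉q → none (x , x∈p , x∉q))

  ⊆∧∣∣≥⇒⊇ : ∀ {p q : Subset m} → p ⊆ q → ∣ q ∣ ≤ ∣ p ∣ → q ⊆ p
  ⊆∧∣∣≥⇒⊇ {p} {q} p⊆q q≤p {x} x∈q = decidable-stable (x ∈? p) λ x∉p →
    <-irrefl refl (≤-trans (p⊂q⇒∣p∣<∣q∣ (p⊆q , x , x∈q , x∉p)) q≤p)

∣p-x∣ : ∀ {m} {p : Subset m} {x} → x ∈ p → ∣ p ∣ ≡ suc ∣ p - x ∣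
∣p-x∣ {p = inside ∷ p} here = cong (suc ∘ ∣_∣) (≡-sym (p─⊥≡p p))
∣p-x∣ {p = inside ∷ p} (there x∈p) = cong suc (∣p-x∣ x∈p)
∣p-x∣ {p = outside ∷ p} (there x∈p) = ∣p-x∣ x∈p

∣p∪⁅x⁆∣ : ∀ {m} {p : Subset m} {x} → x ∉ p → ∣ p ∪ ⁅ x ⁆ ∣ ≡ suc ∣ p ∣
∣p∪⁅x⁆∣ {p = p} {x} x∉p = trans (∣p-x∣ (x∈p∪⁅x⁆ {p = p})) (cong (suc ∘ ∣_∣) (⊆-antisym to from))
  where
  to : p ∪ ⁅ x ⁆ - x ⊆ p
  to y∈ with x∈p∪⁅y⁆⁻ {p = p} (x∈p-y⇒x∈p y∈)
  ... | inj₁ y∈p = y∈p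
  ... | inj₂ y≡x = ⊥-elim (x∈p-y⇒x≢y y∈ y≡x)
  from : p ⊆ p ∪ ⁅ x ⁆ - x
  from y∈p = x∈p∧x≢y⇒x∈p-y (p⊆p∪⁅x⁆ y∈p) λ { refl → x∉p y∈p }

-- Induction on `C`: each member of `C` cancels its own image in `D`. The two correspondences spare
-- the construction of an image set.
∣image∣ : ∀ {m n} (f : Fin m → Fin n) → (∀ {i j} → f i ≡ f j → i ≡ j) →
          (C : Subset m) (D : Subset n) →
          (∀ {i} → i ∈ C → f i ∈ D) → (∀ {x} → x ∈ D → ∃ λ i → i ∈ C × f i ≡ x) → ∣ D ∣ ≡ ∣ C ∣
∣image∣ {n = n} f inj [] D into onto =
  trans (cong ∣_∣ (Empty-unique λ { (_ , x∈D) → case onto x∈D of λ { (() , _) } })) (∣⊥∣≡0 n)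
∣image∣ f inj (outside ∷ C) D into onto =
  ∣image∣ (f ∘ suc) (Fin-suc-injective ∘ inj) C D (into ∘ there)
    λ x∈D → case onto x∈D of λ { (suc i , there i∈C , eq) → i , i∈C , eq }
∣image∣ f inj (inside ∷ C) D into onto =
  trans (∣p-x∣ (into here)) (cong suc (∣image∣ (f ∘ suc) (Fin-suc-injective ∘ inj) C (D - f zero)
    (λ i∈C → x∈p∧x≢y⇒x∈p-y (into (there i∈C)) λ eq → case inj eq of λ ())
    λ x∈D → case onto (x∈p-y⇒x∈p x∈D) of λ
      { (zero , _ , eq) → ⊥-elim (x∈p-y⇒x≢y x∈D (≡-sym eq))
      ; (suc i , there i∈C , eq) → i , i∈C , eq }))

enumerate : ∀ {n} (U : Subset n) → Σ (Fin ∣ U ∣ → Fin n) λ f →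
            (∀ {i j} → f i ≡ f j → i ≡ j) × (∀ i → f i ∈ U) × (∀ {x} → x ∈ U → ∃ λ i → f i ≡ x)
enumerate [] = (λ ()) , (λ { {()} }) , (λ ()) , λ ()
enumerate (outside ∷ U) with enumerate U
... | f , inj , into , onto = suc ∘ f , inj ∘ Fin-suc-injective , there ∘ into , onto′
  where
  onto′ : ∀ {x} → x ∈ outside ∷ U → ∃ λ i → suc (f i) ≡ x
  onto′ (there x∈U) with onto x∈U
  ... | i , eq = i , cong suc eq
enumerate {suc n} (inside ∷ U) with enumerate U
... | f , inj , into , onto = g , g-inj , g-into , g-onto
  where
  g : Fin (suc ∣ U ∣) → Fin (suc n)
  g zero = zero
  g (suc i) = suc (f i)
  g-inj : ∀ {i j} → g i ≡ g j → i ≡ j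
  g-inj {zero} {zero} _ = refl
  g-inj {suc _} {suc _} eq = cong suc (inj (Fin-suc-injective eq))
  g-into : ∀ i → g i ∈ inside ∷ U
  g-into zero = here
  g-into (suc i) = there (into i)
  g-onto : ∀ {x} → x ∈ inside ∷ U → ∃ λ i → g i ≡ x
  g-onto here = zero , refl
  g-onto (there x∈U) with onto x∈U
  ... | i , eq = suc i , cong suc eq

⟦_⟧ : ∀ {m} {P : Fin m → Set} → (∀ x → Dec (P x)) → Subset m
⟦ P? ⟧ = tabulate (does ∘ P?)

∈⟦⟧⁺ : ∀ {m} {P : Fin m → Set} (P? : ∀ x → Dec (P x)) {x} → P x → x ∈ ⟦ P? ⟧
∈⟦⟧⁺ P? {x} px = lookup⇒[]= x _ (trans (lookup∘tabulate _ x) (dec-true (P? x) px))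

∈⟦⟧⁻ : ∀ {m} {P : Fin m → Set} (P? : ∀ x → Dec (P x)) {x} → x ∈ ⟦ P? ⟧ → P x
∈⟦⟧⁻ P? {x} x∈ with P? x | trans (≡-sym (lookup∘tabulate (does ∘ P?) x)) ([]=⇒lookup x∈)
... | yes px | _ = px
... | no _ | ()

T⇒∈ : ∀ {m} {C : Subset m} {i} → T (Vec.lookup C i) → i ∈ C
T⇒∈ {C = C} {i} t = lookup⇒[]= i C (Equivalence.to T-≡ t)

∈⇒T : ∀ {m} {C : Subset m} {i} → i ∈ C → T (Vec.lookup C i)
∈⇒T i∈C = Equivalence.from T-≡ ([]=⇒lookup i∈C)

module _ (G : Graph) where

  private
    V : Set
    V = Fin (n G)

  -- Adjacency, neighbourhoods and cliques

  Adj? : ∀ x y → Dec (Adj G x y)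
  Adj? x y = T? (E G x y)

  Adj-sym : ∀ {x y} → Adj G x y → Adj G y x
  Adj-sym {x} {y} = subst T (sym G x y)

  Adj⇒≢ : ∀ {x y} → Adj G x y → x ≢ y
  Adj⇒≢ {x} a refl = subst T (irrefl G x) a

  N : V → Subset (n G)
  N v = ⟦ Adj? v ⟧

  ∈N⁺ : ∀ {v x} → Adj G v x → x ∈ N v
  ∈N⁺ {v} = ∈⟦⟧⁺ (Adj? v)

  ∈N⁻ : ∀ {v x} → x ∈ N v → Adj G v x
  ∈N⁻ {v} = ∈⟦⟧⁻ (Adj? v)

  clique-⊆ : ∀ {S S′} → S ⊆ S′ → IsClique G S′ → IsClique G S
  clique-⊆ S⊆S′ cl i j i∈S j∈S = cl i j (S⊆S′ i∈S) (S⊆S′ j∈S)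

  clique-∪⁅⁆ : ∀ {S x} → IsClique G S → (∀ {s} → s ∈ S → Adj G s x) → IsClique G (S ∪ ⁅ x ⁆)
  clique-∪⁅⁆ {S} {x} cl adj i j i∈ j∈ i≢j with x∈p∪⁅y⁆⁻ i∈ | x∈p∪⁅y⁆⁻ j∈
  ... | inj₁ i∈S | inj₁ j∈S = cl i j i∈S j∈S i≢j
  ... | inj₁ i∈S | inj₂ refl = adj i∈S
  ... | inj₂ refl | inj₁ j∈S = Adj-sym (adj j∈S)
  ... | inj₂ refl | inj₂ refl = ⊥-elim (i≢j refl)

  clique-⁅⁆ : ∀ x → IsClique G ⁅ x ⁆
  clique-⁅⁆ x i j i∈ j∈ i≢j = ⊥-elim (i≢j (trans (x∈⁅y⁆⇒x≡y x i∈) (≡-sym (x∈⁅y⁆⇒x≡y x j∈))))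

  -- Walks and induced paths

  -- Repeated vertices are allowed and `P` confines the whole walk. Separation becomes the absence
  -- of such a walk, which is easier to cut and join than a path.
  data Conn (P : V → Set) : V → V → Set where
    stop : ∀ {a} → P a → Conn P a a
    go   : ∀ {a b c} → P a → Adj G a b → Conn P b c → Conn P a c

  Conn-map : ∀ {P Q : V → Set} → (∀ {x} → P x → Q x) → ∀ {a b} → Conn P a b → Conn Q a b
  Conn-map f (stop p) = stop (f p)
  Conn-map f (go p e w) = go (f p) e (Conn-map f w)

  Conn-++ : ∀ {P a b c} → Conn P a b → Conn P b c → Conn P a c
  Conn-++ (stop _) w′ = w′
  Conn-++ (go p e w) w′ = go p e (Conn-++ w w′)

  Conn-head : ∀ {P a b} → Conn P a b → P a
  Conn-head (stop p) = p
  Conn-head (go p _ _) = p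

  Conn-reverse : ∀ {P a b} → Conn P a b → Conn P b a
  Conn-reverse (stop p) = stop p
  Conn-reverse (go p e w) = Conn-++ (Conn-reverse w) (go (Conn-head w) (Adj-sym e) (stop p))

  Conn-cross : ∀ {P a b} (Q : Subset (n G)) → Conn P a b → a ∈ Q → b ∉ Q →
               ∃₂ λ p q → Adj G p q × p ∈ Q × q ∉ Q × P p × P q
  Conn-cross Q (stop _) a∈Q b∉Q = ⊥-elim (b∉Q a∈Q)
  Conn-cross Q (go {a} {b} p e w) a∈Q b∉Q with b ∈? Q
  ... | yes b∈Q = Conn-cross Q w b∈Q b∉Q
  ... | no ∉Q = a , b , e , a∈Q , ∉Q , p , Conn-head w

  -- The vertices before and after a visit to `v` are neighbours of `v`, hence equal or adjacent, so
  -- every visit can be cut out.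
  Conn-bypass : ∀ {P v} → (∀ {x y} → P x → P y → Adj G v x → Adj G v y → x ≢ y → Adj G x y) →
                ∀ {a b} → a ≢ v → b ≢ v → Conn P a b → Conn (λ x → P x × x ≢ v) a b
  Conn-bypass cl a≢v b≢v (stop p) = stop (p , a≢v)
  Conn-bypass {v = v} cl a≢v c≢v (go {b = b} p e w) with b ≟ v
  ... | no b≢v = go (p , a≢v) e (Conn-bypass cl b≢v c≢v w)
  Conn-bypass cl a≢v c≢v (go p e (stop _)) | yes refl = ⊥-elim (c≢v refl)
  Conn-bypass cl {a} a≢v c≢v (go p e (go {b = d} _ e′ w)) | yes refl with a ≟ d
  ... | yes refl = Conn-bypass cl a≢v c≢v w
  ... | no a≢d = go (p , a≢v) (cl p (Conn-head w) (Adj-sym e) e′ a≢d)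
                    (Conn-bypass cl (Adj⇒≢ (Adj-sym e′)) c≢v w)

  Far : V → V → Set
  Far a x = a ≢ x × ¬ Adj G a x

  -- Ind a xs b: the vertices a ∷ xs form, in this order, an induced path ending in b.
  data Ind : V → List V → V → Set where
    stop : ∀ {a} → Ind a [] a
    go   : ∀ {a x xs b} → Adj G a x → All (Far a) xs → Ind x xs b → Ind a (x ∷ xs) b

  Ind-head-fresh : ∀ {a xs b} → Ind a xs b → All (a ≢_) xs
  Ind-head-fresh stop = []
  Ind-head-fresh (go e far _) = Adj⇒≢ e ∷ All.map proj₁ far

  -- The path is scanned from its far end for the last vertex equal or adjacent to `a`. Everything
  -- after that vertex is far from `a`, so the path can be cut there and, in the adjacent case, `a`
  -- put in front; the result is again induced.
  Ind-cons : ∀ {P : V → Set} {x xs b} a → P a → Ind x xs b → All P (x ∷ xs) →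
             All (Far a) (x ∷ xs) ⊎ ∃ λ ys → Ind a ys b × All P (a ∷ ys)
  Ind-cons-free : ∀ {P : V → Set} {x xs b} a → P a → All (Far a) xs → Ind x xs b → All P (x ∷ xs) →
                  All (Far a) (x ∷ xs) ⊎ ∃ λ ys → Ind a ys b × All P (a ∷ ys)
  Ind-cons a pa stop ps = Ind-cons-free a pa [] stop ps
  Ind-cons a pa w@(go _ _ w′) (p ∷ ps) with Ind-cons a pa w′ ps
  ... | inj₁ free = Ind-cons-free a pa free w (p ∷ ps)
  ... | inj₂ found = inj₂ found
  Ind-cons-free {x = x} a pa free w ps with a ≟ x | Adj? a x
  ... | yes refl | _ = inj₂ (_ , w , ps)
  ... | no _ | yes e = inj₂ (_ , go e free w , pa ∷ ps)
  ... | no a≢x | no ¬e = inj₁ ((a≢x , ¬e) ∷ free)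

  Conn⇒Ind : ∀ {P a b} → Conn P a b → ∃ λ xs → Ind a xs b × All P (a ∷ xs)
  Conn⇒Ind (stop p) = [] , stop , p ∷ []
  Conn⇒Ind (go {a} p e w) with Conn⇒Ind w
  ... | xs , i , ps with Ind-cons a p i ps
  ...   | inj₁ ((_ , ¬e) ∷ _) = ⊥-elim (¬e e)
  ...   | inj₂ found = found

  Ind⇒Walk : ∀ {a xs b} → Ind a xs b → Σ (Walk G a b) λ w → verts w ≡ a ∷ xs
  Ind⇒Walk stop = [] , refl
  Ind⇒Walk (go e _ i) with Ind⇒Walk i
  ... | w , eq = e ∷ w , cong (_ ∷_) eq

  Ind-unique : ∀ {a xs b} → Ind a xs b → Unique (a ∷ xs)
  Ind-unique stop = [] ∷ []
  Ind-unique i@(go _ _ i′) = Ind-head-fresh i ∷ Ind-unique i′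

  Ind⇒Conn : ∀ {P : V → Set} {a xs b} → Ind a xs b → All P (a ∷ xs) → Conn P a b
  Ind⇒Conn stop (p ∷ []) = stop p
  Ind⇒Conn (go e _ i) (p ∷ ps) = go p e (Ind⇒Conn i ps)

  Walk⇒Conn : ∀ {P : V → Set} {a b} (w : Walk G a b) → All P (verts w) → Conn P a b
  Walk⇒Conn [] (p ∷ []) = stop p
  Walk⇒Conn (e ∷ w) (p ∷ ps) = go p e (Walk⇒Conn w ps)

  Ind-step : ∀ {a xs b} → Ind a xs b → ∀ i j → toℕ j ≡ suc (toℕ i) →
             Adj G (lookup (a ∷ xs) i) (lookup (a ∷ xs) j)
  Ind-step (go e _ _) zero (suc zero) _ = e
  Ind-step (go _ _ w) (suc i) (suc j) eq = Ind-step w i j (suc-injective eq)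

  Ind-far : ∀ {a xs b} → Ind a xs b → ∀ i j → suc (toℕ i) < toℕ j →
            Far (lookup (a ∷ xs) i) (lookup (a ∷ xs) j)
  Ind-far (go {xs = xs} _ far _) zero (suc (suc j)) _ = All.lookup far (∈-lookup j)
  Ind-far (go _ _ _) zero (suc zero) (s≤s ())
  Ind-far (go _ _ w) (suc i) (suc j) (s≤s lt) = Ind-far w i j lt

  Ind-last : ∀ {a xs b} → Ind a xs b → ∀ i → toℕ i ≡ length xs → lookup (a ∷ xs) i ≡ b
  Ind-last stop zero _ = refl
  Ind-last (go _ _ w) (suc i) eq = Ind-last w i (suc-injective eq)

  Ind-< : ∀ {a xs b} → Ind a xs b → ∀ i j → toℕ i < toℕ j → lookup (a ∷ xs) i ≢ lookup (a ∷ xs) j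
  Ind-< w i j lt with m≤n⇒m<n∨m≡n lt
  ... | inj₁ lt′ = proj₁ (Ind-far w i j lt′)
  ... | inj₂ eq = Adj⇒≢ (Ind-step w i j (≡-sym eq))

  Ind-injective : ∀ {a xs b} → Ind a xs b → ∀ i j → lookup (a ∷ xs) i ≡ lookup (a ∷ xs) j → i ≡ j
  Ind-injective w i j eq with <-cmp (toℕ i) (toℕ j)
  ... | tri< lt _ _ = ⊥-elim (Ind-< w i j lt eq)
  ... | tri≈ _ e _ = toℕ-injective e
  ... | tri> _ _ gt = ⊥-elim (Ind-< w j i gt (≡-sym eq))

  Ind-adj : ∀ {a xs b} → Ind a xs b → ∀ i j → Adj G (lookup (a ∷ xs) i) (lookup (a ∷ xs) j) →
            toℕ j ≡ suc (toℕ i) ⊎ toℕ i ≡ suc (toℕ j)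
  Ind-adj w i j e with <-cmp (toℕ i) (toℕ j)
  ... | tri≈ _ eq _ = ⊥-elim (Adj⇒≢ e (cong (lookup _) (toℕ-injective eq)))
  ... | tri< lt _ _ with m≤n⇒m<n∨m≡n lt
  ...   | inj₁ lt′ = ⊥-elim (proj₂ (Ind-far w i j lt′) e)
  ...   | inj₂ eq = inj₁ (≡-sym eq)
  Ind-adj w i j e | tri> _ _ gt with m≤n⇒m<n∨m≡n gt
  ...   | inj₁ gt′ = ⊥-elim (proj₂ (Ind-far w j i gt′) (Adj-sym e))
  ...   | inj₂ eq = inj₂ (≡-sym eq)

  Ind-last⁻ : ∀ {a xs b} → Ind a xs b → ∀ i → lookup (a ∷ xs) i ≡ b → toℕ i ≡ length xs
  Ind-last⁻ {xs = xs} w i eq = trans (cong toℕ (Ind-injective w i last (trans eq (≡-sym (Ind-last w last toℕ-last))))) toℕ-last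
    where
    last = fromℕ (length xs)
    toℕ-last = toℕ-fromℕ (length xs)

  -- The path is cut at its first neighbour `y` of `s`. The last component, quantified over all `P`,
  -- expresses that the vertices of `ys` occur among `xs`.
  Ind-first-neighbour : ∀ {a xs b s} → Ind a xs b → Adj G s b → ∃₂ λ ys y →
    Ind a ys y × Adj G s y × All (λ z → z ≡ y ⊎ ¬ Adj G s z) (a ∷ ys) ×
    (∀ {P : V → Set} → All P xs → All P ys)
  Ind-first-neighbour stop sb = [] , _ , stop , sb , inj₁ refl ∷ [] , id
  Ind-first-neighbour {a} {s = s} (go e far w) sb with Adj? s a
  ... | yes sa = [] , a , stop , sa , inj₁ refl ∷ [] , λ _ → []
  ... | no ¬sa with Ind-first-neighbour w sb
  ...   | ys , y , w′ , sy , inner , sub =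
    _ , y , go e (sub far) w′ , sy , inj₂ ¬sa ∷ inner , λ { (p ∷ ps) → p ∷ sub ps }

  -- Simplicial vertices of chordal graphs

  Touches : Subset (n G) → V → Set
  Touches X z = ∃ λ x → x ∈ X × Adj G x z

  Touches? : ∀ X z → Dec (Touches X z)
  Touches? X z = any? λ x → x ∈? X ×-dec Adj? x z

  Outside : Subset (n G) → Subset (n G) → V → Set
  Outside U X z = z ∈ U × z ∉ X × ¬ Touches X z

  Outside? : ∀ U X z → Dec (Outside U X z)
  Outside? U X z = z ∈? U ×-dec ¬? (z ∈? X) ×-dec ¬? (Touches? X z)

  record Core (U : Subset (n G)) : Set where
    field
      X         : Subset (n G)
      X⊆U       : X ⊆ U
      nonempty  : Nonempty X
      connected : ∀ {a b} → a ∈ X → b ∈ X → Conn (_∈ X) a b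
      outside-X : ∃ (Outside U X)
  open Core

  Dominating : ∀ {U} → Core U → Set
  Dominating {U} c = ∀ {d b} → d ∈ U → d ∉ X c → Touches (X c) d → Outside U (X c) b → Adj G d b

  -- If a boundary vertex `d` misses some outside vertex `b`, then `X` with `d` added is still
  -- connected and still leaves `b` outside. `X` cannot grow forever, and once it stops no such pair
  -- is left.
  dominating-core : ∀ {U} (c : Core U) → Acc _<_ (n G ∸ ∣ X c ∣) → Σ (Core U) Dominating
  dominating-core {U} c (acc rec)
    with any? (λ d → any? (λ b → d ∈? U ×-dec ¬? (d ∈? X c) ×-dec Touches? (X c) d ×-dec Outside? U (X c) b ×-dec ¬? (Adj? d b)))
  ... | no none = c , λ {d} {b} d∈U d∉X t o → decidable-stable (Adj? d b) λ ¬db → none (d , b , d∈U , d∉X , t , o , ¬db)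
  ... | yes (d , b , d∈U , d∉X , (x , x∈X , xd) , (b∈U , b∉X , ¬tb) , ¬db) = dominating-core c′ (rec smaller)
    where
    X′ = X c ∪ ⁅ d ⁆
    to-d : ∀ {a} → a ∈ X′ → Conn (_∈ X′) a d
    to-d a∈ with x∈p∪⁅y⁆⁻ a∈
    ... | inj₁ a∈X = Conn-++ (Conn-map p⊆p∪⁅x⁆ (connected c a∈X x∈X)) (go (p⊆p∪⁅x⁆ x∈X) xd (stop (x∈p∪⁅x⁆ {p = X c})))
    ... | inj₂ refl = stop a∈
    b∉X′ : b ∉ X′
    b∉X′ b∈ with x∈p∪⁅y⁆⁻ b∈
    ... | inj₁ b∈X = b∉X b∈X
    ... | inj₂ refl = ¬tb (x , x∈X , xd)
    ¬tb′ : ¬ Touches X′ b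
    ¬tb′ (y , y∈ , yb) with x∈p∪⁅y⁆⁻ y∈
    ... | inj₁ y∈X = ¬tb (y , y∈X , yb)
    ... | inj₂ refl = ¬db yb
    c′ : Core U
    c′ = record
      { X = X′
      ; X⊆U = ∪⁅⁆-⊆ (X⊆U c) d∈U
      ; nonempty = d , x∈p∪⁅x⁆ {p = X c}
      ; connected = λ a∈ b∈ → Conn-++ (to-d a∈) (Conn-reverse (to-d b∈))
      ; outside-X = b , b∈U , b∉X′ , ¬tb′
      }
    smaller : n G ∸ ∣ X′ ∣ < n G ∸ ∣ X c ∣
    smaller = ∸-monoʳ-< (≤-reflexive (≡-sym (∣p∪⁅x⁆∣ d∉X))) (∣p∣≤n X′)

  module _ (chordal : Chordal G) where

    -- Joining `s` to both ends of the path gives a cycle on at least four vertices. The path is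
    -- induced and `s` sees only its ends, so the cycle has no chord.
    no-hole : ∀ {a xs b s} → Ind a xs b → 2 ≤ length xs → Adj G s a → Adj G s b →
              All (s ≢_) (a ∷ xs) → All (λ z → z ≡ b ⊎ ¬ Adj G s z) xs → Empty
    no-hole {a} {xs} {b} {s} w 2≤ sa sb fresh inner =
      chordless (chordal (suc (length xs)) (s≤s 2≤) c (inj , consec))
      where
      c : Fin (suc (suc (length xs))) → V
      c = lookup (s ∷ a ∷ xs)
      inj : ∀ i j → c i ≡ c j → i ≡ j
      inj zero zero _ = refl
      inj zero (suc j) eq = ⊥-elim (All.lookup fresh (∈-lookup j) eq)
      inj (suc i) zero eq = ⊥-elim (All.lookup fresh (∈-lookup i) (≡-sym eq))
      inj (suc i) (suc j) eq = cong suc (Ind-injective w i j eq)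
      consec : ∀ i j → Consec (suc (length xs)) i j → Adj G (c i) (c j)
      consec zero (suc zero) (inj₁ _) = sa
      consec (suc i) (suc j) (inj₁ eq) = Ind-step w i j (suc-injective eq)
      consec (suc i) zero (inj₂ (eq , _)) =
        subst (λ z → Adj G z s) (≡-sym (Ind-last w i (suc-injective eq))) (Adj-sym sb)
      end : ∀ i → Adj G s (lookup (a ∷ xs) i) → toℕ i ≡ 0 ⊎ toℕ i ≡ length xs
      end zero _ = inj₁ refl
      end (suc i) e with All.lookup inner (∈-lookup i)
      ... | inj₁ eq = inj₂ (Ind-last⁻ w (suc i) eq)
      ... | inj₂ ¬e = ⊥-elim (¬e e)
      chordless : ¬ HasChord G (suc (length xs)) c
      chordless (zero , zero , i≢j , _) = i≢j refl
      chordless (suc i , suc j , _ , ¬ij , ¬ji , e) =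
        [ ¬ij ∘ inj₁ ∘ cong suc , ¬ji ∘ inj₁ ∘ cong suc ]′ (Ind-adj w i j e)
      chordless (zero , suc j , _ , ¬ij , ¬ji , e) =
        [ ¬ij ∘ inj₁ ∘ cong suc , (λ eq → ¬ji (inj₂ (cong suc eq , refl))) ]′ (end j e)
      chordless (suc i , zero , _ , ¬ij , ¬ji , e) =
        [ ¬ji ∘ inj₁ ∘ cong suc , (λ eq → ¬ij (inj₂ (cong suc eq , refl))) ]′ (end i (Adj-sym e))

    -- If the vertex `x` after `a` is not adjacent to `s`, the stretch from `a` to the next
    -- neighbour of `s` closes up with `s` to a hole. Otherwise the argument continues from `x`.
    Ind-common-neighbour : ∀ {a xs b s} → Ind a xs b → Adj G s a → Adj G s b → All (s ≢_) (a ∷ xs) →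
                           All (Adj G s) (a ∷ xs)
    Ind-common-neighbour stop sa _ _ = sa ∷ []
    Ind-common-neighbour {s = s} (go {x = x} e far w) sa sb (f ∷ fs) with Adj? s x
    ... | yes sx = sa ∷ Ind-common-neighbour w sx sb fs
    ... | no ¬sx with Ind-first-neighbour w sb
    ...   | [] , _ , stop , sx , _ = ⊥-elim (¬sx sx)
    ...   | _ ∷ _ , _ , w′ , sy , inner , sub =
      ⊥-elim (no-hole (go e (sub far) w′) (s≤s (s≤s z≤n)) sa sy (f ∷ All.head fs ∷ sub (All.tail fs)) inner)

    -- A vertex b outside the closed neighbourhood of X is a common neighbour of any two boundary
    -- vertices, so if these were not adjacent, b would close an induced path through X to a hole.
    boundary-adj : ∀ {U} (c : Core U) → Dominating c → ∀ {d d′} → d ∈ U → d′ ∈ U → d ∉ X c → d′ ∉ X c →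
                   Touches (X c) d → Touches (X c) d′ → d ≢ d′ → Adj G d d′
    boundary-adj {U} c dom {d} {d′} d∈U d′∈U d∉X d′∉X td@(x , x∈X , xd) td′@(x′ , x′∈X , x′d′) d≢d′
      with outside-X c
    ... | b , ob@(_ , b∉X , ¬tb) with Conn⇒Ind path
      where
      P : V → Set
      P z = z ∈ X c ⊎ z ≡ d ⊎ z ≡ d′
      path : Conn P d d′
      path = go (inj₂ (inj₁ refl)) (Adj-sym xd)
        (Conn-++ (Conn-map inj₁ (connected c x∈X x′∈X)) (go (inj₁ x′∈X) x′d′ (stop (inj₂ (inj₂ refl)))))
    ...   | [] , stop , _ = ⊥-elim (d≢d′ refl)
    ...   | _ ∷ [] , go e _ stop , _ = e
    ...   | xs@(_ ∷ _ ∷ _) , w , ps = ⊥-elim (no-hole w (s≤s (s≤s z≤n)) bd bd′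
              (All.map fresh ps) (All.zipWith inner (Ind-head-fresh w , All.tail ps)))
      where
      bd = Adj-sym (dom d∈U d∉X td ob)
      bd′ = Adj-sym (dom d′∈U d′∉X td′ ob)
      fresh : ∀ {z} → z ∈ X c ⊎ z ≡ d ⊎ z ≡ d′ → b ≢ z
      fresh (inj₁ z∈X) refl = b∉X z∈X
      fresh (inj₂ (inj₁ refl)) = Adj⇒≢ bd
      fresh (inj₂ (inj₂ refl)) = Adj⇒≢ bd′
      inner : ∀ {z} → d ≢ z × (z ∈ X c ⊎ z ≡ d ⊎ z ≡ d′) → z ≡ d′ ⊎ ¬ Adj G b z
      inner {z} (_ , inj₁ z∈X) = inj₂ λ bz → ¬tb (z , z∈X , Adj-sym bz)
      inner (d≢z , inj₂ (inj₁ refl)) = ⊥-elim (d≢z refl)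
      inner (_ , inj₂ (inj₂ eq)) = inj₁ eq

    -- Induction on the size of `U`. In a clique any vertex serves; otherwise two non-adjacent
    -- vertices `x` and `y` supply the initial core `⁅ x ⁆`, with `y` outside.
    simplicial : ∀ U → Nonempty U → Acc _<_ ∣ U ∣ → ∃ λ v → v ∈ U × IsClique G (N v ∩ U)
    simplicial U (u , u∈U) (acc rec)
      with any? (λ x → any? (λ y → x ∈? U ×-dec y ∈? U ×-dec ¬? (x ≟ y) ×-dec ¬? (Adj? x y)))
    ... | no none = u , u∈U , λ i j i∈ j∈ i≢j → decidable-stable (Adj? i j) λ ¬ij →
            none (i , j , ∈∩ʳ i∈ , ∈∩ʳ j∈ , i≢j , ¬ij)
    ... | yes (x , y , x∈U , y∈U , x≢y , ¬xy) with dominating-core c₀ (<-wellFounded _)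
      where
      c₀ : Core U
      c₀ = record
        { X = ⁅ x ⁆
        ; X⊆U = λ z∈ → subst (_∈ U) (≡-sym (x∈⁅y⁆⇒x≡y x z∈)) x∈U
        ; nonempty = x , x∈⁅x⁆ x
        ; connected = λ a∈ b∈ → subst₂ (Conn (_∈ ⁅ x ⁆)) (≡-sym (x∈⁅y⁆⇒x≡y x a∈)) (≡-sym (x∈⁅y⁆⇒x≡y x b∈)) (stop (x∈⁅x⁆ x))
        ; outside-X = y , y∈U , (λ y∈ → x≢y (≡-sym (x∈⁅y⁆⇒x≡y x y∈))) ,
            λ { (z , z∈ , zy) → ¬xy (subst (λ z → Adj G z y) (x∈⁅y⁆⇒x≡y x z∈) zy) }
        }
    ... | c , dom with simplicial B (proj₁ (outside-X c) , ∈⟦⟧⁺ (Outside? U (X c)) (proj₂ (outside-X c))) (rec (p⊂q⇒∣p∣<∣q∣ B⊂U))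
      where
      B = ⟦ Outside? U (X c) ⟧
      B⊂U : B ⊂ U
      B⊂U = proj₁ ∘ ∈⟦⟧⁻ (Outside? U (X c)) , proj₁ (nonempty c) , X⊆U c (proj₂ (nonempty c)) ,
        λ z∈B → proj₁ (proj₂ (∈⟦⟧⁻ (Outside? U (X c)) z∈B)) (proj₂ (nonempty c))
    ...   | b , b∈B , cl = b , proj₁ ob , clique
      where
      ob : Outside U (X c) b
      ob = ∈⟦⟧⁻ (Outside? U (X c)) b∈B
      -- No neighbour of `b` lies in `X`, because `X` does not touch `b`; so each one is a boundary
      -- vertex or belongs to `B`.
      split : ∀ {i} → i ∈ N b ∩ U → (i ∉ X c × Touches (X c) i) ⊎ Outside U (X c) i
      split {i} i∈ with Touches? (X c) i
      ... | yes t = inj₁ ((λ i∈X → proj₂ (proj₂ ob) (i , i∈X , Adj-sym (∈N⁻ (∈∩ˡ i∈)))) , t)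
      ... | no ¬t = inj₂ (∈∩ʳ i∈ , (λ i∈X → proj₂ (proj₂ ob) (i , i∈X , Adj-sym (∈N⁻ (∈∩ˡ i∈)))) , ¬t)
      clique : IsClique G (N b ∩ U)
      clique i j i∈ j∈ i≢j with split i∈ | split j∈
      ... | inj₁ (i∉X , ti) | inj₁ (j∉X , tj) = boundary-adj c dom (∈∩ʳ i∈) (∈∩ʳ j∈) i∉X j∉X ti tj i≢j
      ... | inj₁ (i∉X , ti) | inj₂ oj = dom (∈∩ʳ i∈) i∉X ti oj
      ... | inj₂ oi | inj₁ (j∉X , tj) = Adj-sym (dom (∈∩ʳ j∈) j∉X tj oi)
      ... | inj₂ oi | inj₂ oj = cl i j (∈∩ (∈∩ˡ i∈) (∈⟦⟧⁺ (Outside? U (X c)) oi)) (∈∩ (∈∩ˡ j∈) (∈⟦⟧⁺ (Outside? U (X c)) oj)) i≢j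

  -- Elimination of simplicial vertices

  -- Separation inside the subgraph induced on `U`, so that it can be compared before and after a
  -- deletion. That the cliques meet is kept as a separate condition.
  Sep : Subset (n G) → Subset (n G) → Subset (n G) → Set
  Sep U Q Q′ = ∀ {a b} → a ∈ Q → a ∉ Q′ → b ∈ Q′ → b ∉ Q → ¬ Conn (λ x → x ∈ U × x ∉ Q ∩ Q′) a b

  Sep-sym : ∀ {U Q Q′} → Sep U Q Q′ → Sep U Q′ Q
  Sep-sym sep a∈Q′ a∉Q b∈Q b∉Q′ w =
    sep b∈Q b∉Q′ a∈Q′ a∉Q (Conn-reverse (Conn-map (λ { (x∈U , x∉) → x∈U , λ x∈ → x∉ (∈∩ (∈∩ʳ x∈) (∈∩ˡ x∈)) }) w))

  ⊆-remove : ∀ {U Q : Subset (n G)} {v} → Q ⊆ U → v ∉ Q → Q ⊆ U - v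
  ⊆-remove Q⊆U v∉Q x∈Q = x∈p∧x≢y⇒x∈p-y (Q⊆U x∈Q) λ { refl → v∉Q x∈Q }

  star : Subset (n G) → V → Subset (n G)
  star U v = (N v ∩ U) ∪ ⁅ v ⁆

  star-clique : ∀ {U v} → IsClique G (N v ∩ U) → IsClique G (star U v)
  star-clique cl = clique-∪⁅⁆ cl (λ s∈ → Adj-sym (∈N⁻ (∈∩ˡ s∈)))

  star-⊆ : ∀ {U v} → v ∈ U → star U v ⊆ U
  star-⊆ v∈U = ∪⁅⁆-⊆ ∈∩ʳ v∈U

  ∣star∣ : ∀ {U v} → ∣ star U v ∣ ≡ suc ∣ N v ∩ U ∣
  ∣star∣ = ∣p∪⁅x⁆∣ λ v∈ → Adj⇒≢ (∈N⁻ (∈∩ˡ v∈)) refl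

  clique-⊆-star : ∀ {U v Q} → Q ⊆ U → IsClique G Q → v ∈ Q → Q ⊆ star U v
  clique-⊆-star {v = v} Q⊆U cl v∈Q {x} x∈Q with v ≟ x
  ... | yes refl = x∈p∪⁅x⁆
  ... | no v≢x = p⊆p∪⁅x⁆ (∈∩ (∈N⁺ (cl v x v∈Q x∈Q v≢x)) (Q⊆U x∈Q))

  -- A walk through `v` is shortcut within the clique `N v ∩ U`. Shortcuts only drop vertices, so
  -- the new walk still avoids `Q ∩ Q′`.
  Sep-insert : ∀ {U Q Q′ v} → IsClique G (N v ∩ U) → v ∉ Q → v ∉ Q′ → Sep (U - v) Q Q′ → Sep U Q Q′
  Sep-insert cl v∉Q v∉Q′ sep a∈Q a∉Q′ b∈Q′ b∉Q w =
    sep a∈Q a∉Q′ b∈Q′ b∉Q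
      (Conn-map (λ { ((x∈U , x∉) , x≢v) → x∈p∧x≢y⇒x∈p-y x∈U x≢v , x∉ })
        (Conn-bypass (λ { (x∈U , _) (y∈U , _) vx vy → cl _ _ (∈∩ (∈N⁺ vx) x∈U) (∈∩ (∈N⁺ vy) y∈U) })
          (λ { refl → v∉Q a∈Q }) (λ { refl → v∉Q′ b∈Q′ }) w))

  Sep⇒SeparatingPair : ∀ {Q Q′} → Nonempty (Q ∩ Q′) → Sep ⊤ Q Q′ → IsSeparatingPair G Q Q′
  Sep⇒SeparatingPair {Q} {Q′} ne sep = ne , λ a b a∈Q a∉Q′ b∈Q′ b∉Q w _ →
    decidable-stable (Any.any? (_∈? (Q ∩ Q′)) (verts w)) λ none →
      sep a∈Q a∉Q′ b∈Q′ b∉Q (Walk⇒Conn w (All.map (∈⊤ ,_) (¬Any⇒All¬ (verts w) none)))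

  -- The definition speaks of paths, so the given walk is first reduced to an induced path, whose
  -- vertices are distinct.
  SeparatingPair⇒Sep : ∀ {Q Q′} → IsSeparatingPair G Q Q′ → Sep ⊤ Q Q′
  SeparatingPair⇒Sep (_ , sep) a∈Q a∉Q′ b∈Q′ b∉Q conn with Conn⇒Ind conn
  ... | xs , i , ps with Ind⇒Walk i
  ...   | w , eq = All¬⇒¬Any (All.map proj₂ (subst (All _) (≡-sym eq) ps))
                     (sep _ _ a∈Q a∉Q′ b∈Q′ b∉Q w (subst Unique (≡-sym eq) (Ind-unique i)))

  maximal-extension : ∀ {Q} → IsClique G Q → Acc _<_ (n G ∸ ∣ Q ∣) → ∃ λ D → Q ⊆ D × IsMaximalClique G D
  maximal-extension {Q} cl (acc rec) with any? (λ w → ¬? (w ∈? Q) ×-dec Q ⊆? N w)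
  ... | yes (w , w∉Q , Q⊆N) with maximal-extension (clique-∪⁅⁆ {x = w} cl (λ s∈ → Adj-sym (∈N⁻ (Q⊆N s∈))))
                                   (rec (∸-monoʳ-< (≤-reflexive (≡-sym (∣p∪⁅x⁆∣ w∉Q))) (∣p∣≤n (Q ∪ ⁅ w ⁆))))
  ...   | D , ⊆D , max = D , (λ x∈Q → ⊆D (p⊆p∪⁅x⁆ x∈Q)) , max
  maximal-extension {Q} cl _ | no none = Q , id , cl , λ T′ clT Q⊆T {w} w∈T → decidable-stable (w ∈? Q) λ w∉Q →
    none (w , w∉Q , λ {x} x∈Q → ∈N⁺ (clT w x w∈T (Q⊆T x∈Q) (λ { refl → w∉Q x∈Q })))

  -- Cliques and separation along an elimination order

  module _ (k : ℕ) where

    -- The recursive definition of a k-tree read backwards inside a fixed graph: the remaining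
    -- vertices form the subset `U`, so no relabelling occurs.
    data Elim (U : Subset (n G)) : Set where
      done   : IsClique G U → ∣ U ∣ ≡ suc k → Elim U
      remove : ∀ v → v ∈ U → IsClique G (N v ∩ U) → ∣ N v ∩ U ∣ ≡ k → Elim (U - v) → Elim U

    TopClique : Subset (n G) → Subset (n G) → Set
    TopClique U Q = Q ⊆ U × IsClique G Q × ∣ Q ∣ ≡ suc k

    -- Equivalent to saying that the maximal cliques of the graph induced on `U` are exactly its
    -- (k+1)-cliques.
    Extensible : Subset (n G) → Set
    Extensible U = ∀ {Q} → Q ⊆ U → IsClique G Q → ∃ λ D → Q ⊆ D × TopClique U D

    SepAdjacent : Subset (n G) → Set
    SepAdjacent U = ∀ {Q Q′} → TopClique U Q → TopClique U Q′ → Q ≢ Q′ → Nonempty (Q ∩ Q′) →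
                    Sep U Q Q′ → ∣ Q ∩ Q′ ∣ ≡ k

    AdjacentSep : Subset (n G) → Set
    AdjacentSep U = ∀ {Q Q′} → TopClique U Q → TopClique U Q′ → ∣ Q ∩ Q′ ∣ ≡ k → Sep U Q Q′

    TopClique-≡ : ∀ {U Q Q′} → TopClique U Q → TopClique U Q′ → Q ⊆ Q′ → Q ≡ Q′
    TopClique-≡ (_ , _ , ∣Q∣) (_ , _ , ∣Q′∣) Q⊆Q′ =
      ⊆-antisym Q⊆Q′ (⊆∧∣∣≥⇒⊇ Q⊆Q′ (≤-reflexive (trans ∣Q′∣ (≡-sym ∣Q∣))))

    ∩-self-≢k : ∀ {U Q} → TopClique U Q → ∣ Q ∩ Q ∣ ≢ k
    ∩-self-≢k {Q = Q} (_ , _ , ∣Q∣) eq = <-irrefl (trans (≡-sym eq) (trans (cong ∣_∣ (∩-idem Q)) ∣Q∣)) (n<1+n k)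

    TopClique-remove : ∀ {U Q v} → TopClique U Q → v ∉ Q → TopClique (U - v) Q
    TopClique-remove (Q⊆U , rest) v∉Q = ⊆-remove Q⊆U v∉Q , rest

    module Simplicial {U v} (v∈U : v ∈ U) (cl : IsClique G (N v ∩ U)) (∣C∣ : ∣ N v ∩ U ∣ ≡ k) where

      star-top : TopClique U (star U v)
      star-top = star-⊆ v∈U , star-clique cl , trans ∣star∣ (cong suc ∣C∣)

      ∋v⇒≡star : ∀ {Q} → TopClique U Q → v ∈ Q → Q ≡ star U v
      ∋v⇒≡star t@(Q⊆U , clQ , _) v∈Q = TopClique-≡ t star-top (clique-⊆-star Q⊆U clQ v∈Q)

      star-∩ : ∀ {Q} → v ∉ Q → star U v ∩ Q ⊆ N v ∩ U
      star-∩ v∉Q x∈ with x∈p∪⁅y⁆⁻ (∈∩ˡ x∈)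
      ... | inj₁ x∈C = x∈C
      ... | inj₂ refl = ⊥-elim (v∉Q (∈∩ʳ x∈))

      C⊆Q : ∀ {Q} → v ∉ Q → ∣ star U v ∩ Q ∣ ≡ k → N v ∩ U ⊆ Q
      C⊆Q v∉Q eq x∈C = ∈∩ʳ (⊆∧∣∣≥⇒⊇ (star-∩ v∉Q) (≤-reflexive (trans ∣C∣ (≡-sym eq))) x∈C)

      -- By `C⊆Q`, all of `star U v` except `v` lies in `Q`, so the walk starts at `v`; its next
      -- vertex is in `N v ∩ U`, hence in both cliques.
      star-Sep : ∀ {Q} → v ∉ Q → ∣ star U v ∩ Q ∣ ≡ k → Sep U (star U v) Q
      star-Sep {Q} v∉Q eq a∈ a∉Q b∈Q b∉ w with x∈p∪⁅y⁆⁻ a∈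
      ... | inj₁ a∈C = a∉Q (C⊆Q v∉Q eq a∈C)
      star-Sep v∉Q eq a∈ a∉Q b∈Q b∉ (stop _) | inj₂ refl = v∉Q b∈Q
      star-Sep {Q} v∉Q eq a∈ a∉Q b∈Q b∉ (go _ e w) | inj₂ refl = proj₂ (Conn-head w) (∈∩ (p⊆p∪⁅x⁆ x∈C) (C⊆Q v∉Q eq x∈C))
        where
        x∈C = ∈∩ (∈N⁺ e) (proj₁ (Conn-head w))

      -- If C = N v ∩ U had a vertex c outside Q, any top clique D ⊇ C of U - v would form a
      -- separating pair with Q as well, and the walk v - c - d with d ∈ (D ∩ Q) \ C gives a contradiction.
      star-SepAdjacent : Extensible (U - v) → SepAdjacent (U - v) → ∀ {Q} → TopClique U Q → v ∉ Q →
                         Nonempty (star U v ∩ Q) → Sep U (star U v) Q → ∣ star U v ∩ Q ∣ ≡ k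
      star-SepAdjacent ext ih {Q} tQ v∉Q (z , z∈) sep with N v ∩ U ⊆? Q
      ... | yes C⊆Q = trans (cong ∣_∣ (⊆-antisym (star-∩ v∉Q) (λ x∈C → ∈∩ (p⊆p∪⁅x⁆ x∈C) (C⊆Q x∈C)))) ∣C∣
      ... | no C⊈Q with ⊈⇒∃ _ _ C⊈Q | ext (⊆-remove ∈∩ʳ (λ v∈ → Adj⇒≢ (∈N⁻ (∈∩ˡ v∈)) refl)) cl
      ...   | c , c∈C , c∉Q | D , C⊆D , tD@(D⊆ , clD , _) = ⊥-elim (no-d (⊈⇒∃ _ _ DQ⊈))
        where
        from-star : ∀ {x} → x ∈ star U v ∩ Q → x ∈ D ∩ Q
        from-star x∈ = ∈∩ (C⊆D (star-∩ v∉Q x∈)) (∈∩ʳ x∈)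
        c-ok : c ∈ U × c ∉ star U v ∩ Q
        c-ok = ∈∩ʳ c∈C , c∉Q ∘ ∈∩ʳ
        via : ∀ {b} → b ∈ Q → b ∉ N v ∩ U → ¬ Conn (λ x → x ∈ U × x ∉ star U v ∩ Q) c b
        via b∈Q b∉C w = sep x∈p∪⁅x⁆ v∉Q b∈Q
          (λ b∈ → b∉C (star-∩ v∉Q (∈∩ b∈ b∈Q)))
          (go (v∈U , v∉Q ∘ ∈∩ʳ) (∈N⁻ (∈∩ˡ c∈C)) w)
        reach : ∀ {a b} → a ∈ D → b ∈ Q → b ∉ D → ¬ Conn (λ x → x ∈ U - v × x ∉ D ∩ Q) a b
        reach {a} a∈D b∈Q b∉D w with c ≟ a
        ... | yes refl = via b∈Q (b∉D ∘ C⊆D) (Conn-map (λ { (x∈ , x∉) → x∈p-y⇒x∈p x∈ , x∉ ∘ from-star }) w)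
        ... | no c≢a = via b∈Q (b∉D ∘ C⊆D) (go c-ok (clD c a (C⊆D c∈C) a∈D c≢a)
                (Conn-map (λ { (x∈ , x∉) → x∈p-y⇒x∈p x∈ , x∉ ∘ from-star }) w))
        ∣DQ∣ : ∣ D ∩ Q ∣ ≡ k
        ∣DQ∣ = ih tD (TopClique-remove tQ v∉Q) (λ { refl → c∉Q (C⊆D c∈C) }) (z , from-star z∈)
                 (λ a∈D _ b∈Q b∉D → reach a∈D b∈Q b∉D)
        DQ⊈ : ¬ D ∩ Q ⊆ N v ∩ U
        DQ⊈ DQ⊆ = <-irrefl (trans ∣DQ∣ (≡-sym ∣C∣)) (p⊂q⇒∣p∣<∣q∣ (DQ⊆ , c , c∈C , c∉Q ∘ ∈∩ʳ))
        no-d : ¬ (∃ λ d → d ∈ D ∩ Q × d ∉ N v ∩ U)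
        no-d (d , d∈ , d∉C) = via (∈∩ʳ d∈) d∉C
          (go c-ok (clD c d (C⊆D c∈C) (∈∩ˡ d∈) (λ { refl → c∉Q (∈∩ʳ d∈) }))
            (stop (x∈p-y⇒x∈p (D⊆ (∈∩ˡ d∈)) , d∉C ∘ star-∩ v∉Q)))

    Elim⇒Extensible : ∀ {U} → Elim U → Extensible U
    Elim⇒Extensible (done cl ∣U∣) Q⊆U clQ = _ , Q⊆U , id , cl , ∣U∣
    Elim⇒Extensible (remove v v∈U cl ∣C∣ el) {Q} Q⊆U clQ with v ∈? Q
    ... | yes v∈Q = _ , clique-⊆-star Q⊆U clQ v∈Q , Simplicial.star-top v∈U cl ∣C∣
    ... | no v∉Q with Elim⇒Extensible el (⊆-remove Q⊆U v∉Q) clQ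
    ...   | D , Q⊆D , D⊆ , rest = D , Q⊆D , (λ x∈D → x∈p-y⇒x∈p (D⊆ x∈D)) , rest

    Elim⇒AdjacentSep : ∀ {U} → Elim U → AdjacentSep U
    -- Both cliques are all of `U` here, and `U` meets itself in k+1 vertices, not in k.
    Elim⇒AdjacentSep (done cl ∣U∣) tQ tQ′ eq
      with refl ← TopClique-≡ tQ (id , cl , ∣U∣) (proj₁ tQ) | refl ← TopClique-≡ tQ′ (id , cl , ∣U∣) (proj₁ tQ′) =
      ⊥-elim (∩-self-≢k tQ eq)
    Elim⇒AdjacentSep {U} (remove v v∈U cl ∣C∣ el) {Q} {Q′} tQ tQ′ eq = by-cases (v ∈? Q) (v ∈? Q′)
      where
      open Simplicial v∈U cl ∣C∣
      by-cases : Dec (v ∈ Q) → Dec (v ∈ Q′) → Sep U Q Q′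
      by-cases (yes v∈Q) (yes v∈Q′) = ⊥-elim (∩-self-≢k tQ
        (subst (λ S → ∣ Q ∩ S ∣ ≡ k) (trans (∋v⇒≡star tQ′ v∈Q′) (≡-sym (∋v⇒≡star tQ v∈Q))) eq))
      by-cases (yes v∈Q) (no v∉Q′) with refl ← ∋v⇒≡star tQ v∈Q = star-Sep v∉Q′ eq
      by-cases (no v∉Q) (yes v∈Q′) with refl ← ∋v⇒≡star tQ′ v∈Q′ =
        Sep-sym (star-Sep v∉Q (trans (cong ∣_∣ (∩-comm Q′ Q)) eq))
      by-cases (no v∉Q) (no v∉Q′) = Sep-insert cl v∉Q v∉Q′
        (Elim⇒AdjacentSep el (TopClique-remove tQ v∉Q) (TopClique-remove tQ′ v∉Q′) eq)

    Elim⇒SepAdjacent : ∀ {U} → Elim U → SepAdjacent U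
    Elim⇒SepAdjacent (done cl ∣U∣) tQ tQ′ Q≢Q′ _ _ =
      ⊥-elim (Q≢Q′ (trans (TopClique-≡ tQ (id , cl , ∣U∣) (proj₁ tQ)) (≡-sym (TopClique-≡ tQ′ (id , cl , ∣U∣) (proj₁ tQ′)))))
    Elim⇒SepAdjacent {U} (remove v v∈U cl ∣C∣ el) {Q} {Q′} tQ tQ′ Q≢Q′ ne@(z , z∈) sep = by-cases (v ∈? Q) (v ∈? Q′)
      where
      open Simplicial v∈U cl ∣C∣
      half : ∀ {Q} → TopClique U Q → v ∉ Q → Nonempty (star U v ∩ Q) → Sep U (star U v) Q → ∣ star U v ∩ Q ∣ ≡ k
      half = star-SepAdjacent (Elim⇒Extensible el) (Elim⇒SepAdjacent el)
      by-cases : Dec (v ∈ Q) → Dec (v ∈ Q′) → ∣ Q ∩ Q′ ∣ ≡ k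
      by-cases (yes v∈Q) (yes v∈Q′) = ⊥-elim (Q≢Q′ (trans (∋v⇒≡star tQ v∈Q) (≡-sym (∋v⇒≡star tQ′ v∈Q′))))
      by-cases (yes v∈Q) (no v∉Q′) with refl ← ∋v⇒≡star tQ v∈Q = half tQ′ v∉Q′ ne sep
      by-cases (no v∉Q) (yes v∈Q′) with refl ← ∋v⇒≡star tQ′ v∈Q′ =
        trans (cong ∣_∣ (∩-comm Q Q′)) (half tQ v∉Q (z , ∈∩ (∈∩ʳ z∈) (∈∩ˡ z∈)) (Sep-sym sep))
      -- Every walk in `U - v` is a walk in `U`, so separation is inherited without rerouting.
      by-cases (no v∉Q) (no v∉Q′) = Elim⇒SepAdjacent el (TopClique-remove tQ v∉Q) (TopClique-remove tQ′ v∉Q′) Q≢Q′ ne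
        λ a∈Q a∉Q′ b∈Q′ b∉Q w → sep a∈Q a∉Q′ b∈Q′ b∉Q (Conn-map (λ { (x∈ , x∉) → x∈p-y⇒x∈p x∈ , x∉ }) w)

    -- Constructing an elimination order in a chordal graph

    module _ (chordal : Chordal G) where

      -- On an induced path from a to b avoiding Q ∩ Q′, every vertex is adjacent to all of Q ∩ Q′
      -- by chordality, so the edge where the path leaves Q extends Q ∩ Q′ to a larger clique.
      enlarge-∩ : ∀ {U Q Q′ a b} → Extensible U → TopClique U Q → TopClique U Q′ →
                  a ∈ Q → b ∈ Q′ → b ∉ Q → Conn (λ x → x ∈ U × x ∉ Q ∩ Q′) a b →
                  ∃ λ Q″ → TopClique U Q″ × Q ≢ Q″ × Nonempty (Q ∩ Q″) × ∣ Q ∩ Q′ ∣ < ∣ Q ∩ Q″ ∣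
      enlarge-∩ {U} {Q} {Q′} {a} {b} ext (Q⊆U , clQ , _) (_ , clQ′ , _) a∈Q b∈Q′ b∉Q conn
        with Conn⇒Ind conn
      ... | xs , w , ps with Conn-cross Q (Ind⇒Conn w (All.zip (ps , complete-to-S))) a∈Q b∉Q
        where
        complete-to-S : All (λ y → ∀ {s} → s ∈ Q ∩ Q′ → Adj G s y) (a ∷ xs)
        complete-to-S = All.tabulate λ y∈ {s} s∈ → All.lookup
          (Ind-common-neighbour chordal w
            (clQ s a (∈∩ˡ s∈) a∈Q (λ { refl → proj₂ (All.head ps) s∈ }))
            (clQ′ s b (∈∩ʳ s∈) b∈Q′ (λ { refl → b∉Q (∈∩ˡ s∈) }))
            (All.map (λ { (_ , y∉) refl → y∉ s∈ }) ps)) y∈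
      ...   | p , q , e , p∈Q , q∉Q , ((p∈U , p∉) , adj-p) , ((q∈U , _) , adj-q)
        with ext {(Q ∩ Q′ ∪ ⁅ p ⁆) ∪ ⁅ q ⁆} (∪⁅⁆-⊆ (∪⁅⁆-⊆ (λ x∈ → Q⊆U (∈∩ˡ x∈)) p∈U) q∈U)
               (clique-∪⁅⁆ (clique-∪⁅⁆ (clique-⊆ ∈∩ˡ clQ) adj-p)
                 (λ s∈ → [ (λ s∈S → adj-q s∈S) , (λ { refl → e }) ]′ (x∈p∪⁅y⁆⁻ s∈)))
      ...     | D , ⊆D , tD = D , tD , (λ { refl → q∉Q (⊆D x∈p∪⁅x⁆) }) , (p , p∈) ,
        p⊂q⇒∣p∣<∣q∣ ((λ x∈ → ∈∩ (∈∩ˡ x∈) (⊆D (p⊆p∪⁅x⁆ (p⊆p∪⁅x⁆ x∈)))) , p , p∈ , p∉)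
        where
        p∈ : p ∈ Q ∩ D
        p∈ = ∈∩ p∈Q (⊆D (p⊆p∪⁅x⁆ x∈p∪⁅x⁆))

      -- This replaces the choice of a largest intersection: if `Q` and `Q′` are separated, they
      -- share k vertices, against `none`; if not, `enlarge-∩` gives a clique meeting `Q` in more
      -- vertices, which cannot go on forever.
      no-adjacent⇒⊥ : ∀ {U Q Q′} → Extensible U → SepAdjacent U → TopClique U Q →
                      (∀ {P} → TopClique U P → Q ≢ P → ∣ Q ∩ P ∣ ≢ k) →
                      TopClique U Q′ → Q ≢ Q′ → Nonempty (Q ∩ Q′) → Acc _<_ (n G ∸ ∣ Q ∩ Q′ ∣) → Empty
      no-adjacent⇒⊥ {Q = Q} ext sa tQ none tQ′ Q≢Q′ ne (acc rec) =
        none tQ′ Q≢Q′ (sa tQ tQ′ Q≢Q′ ne λ a∈Q _ b∈Q′ b∉Q w →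
          case enlarge-∩ ext tQ tQ′ a∈Q b∈Q′ b∉Q w of λ
            { (Q″ , tQ″ , Q≢Q″ , ne″ , lt) →
              no-adjacent⇒⊥ ext sa tQ none tQ″ Q≢Q″ ne″ (rec (∸-monoʳ-< lt (∣p∣≤n (Q ∩ Q″)))) })

      -- Extensibility, `SepAdjacent` and connectedness are the invariants that pass from `U` to
      -- `U - v`; chordality belongs to the whole graph and serves every `U`.
      Elim-build : ∀ U → Acc _<_ ∣ U ∣ → Extensible U → SepAdjacent U →
                   (∀ {a b} → a ∈ U → b ∈ U → Conn (_∈ U) a b) → Elim U
      Elim-build U (acc rec) ext sa conn with simplicial chordal U nonemptyU (<-wellFounded _)
        where
        nonemptyU : Nonempty U
        nonemptyU with ext {⊥} (λ x∈ → ⊥-elim (∉⊥ x∈)) (λ _ _ x∈ → ⊥-elim (∉⊥ x∈))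
        ... | D , _ , D⊆U , _ , ∣D∣ with nonempty? D
        ...   | yes (x , x∈D) = x , D⊆U x∈D
        ...   | no empty = case trans (≡-sym ∣D∣) (trans (cong ∣_∣ (Empty-unique empty)) (∣⊥∣≡0 (n G))) of λ ()
      ... | v , v∈U , cl = by-cases (U ⊆? star U v)
        where
        ∣C∣ : ∣ N v ∩ U ∣ ≡ k
        -- An extension `D` of the star contains `v`, so it lies in the star too; hence the star
        -- itself has k+1 elements.
        ∣C∣ with ext (star-⊆ v∈U) (star-clique cl)
        ... | D , star⊆D , D⊆U , clD , ∣D∣ = suc-injective (trans (≡-sym ∣star∣) (trans
          (≤-antisym (p⊆q⇒∣p∣≤∣q∣ star⊆D) (p⊆q⇒∣p∣≤∣q∣ (clique-⊆-star D⊆U clD (star⊆D x∈p∪⁅x⁆)))) ∣D∣))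
        open Simplicial v∈U cl ∣C∣

        v∉C : v ∉ N v ∩ U
        v∉C v∈ = Adj⇒≢ (∈N⁻ (∈∩ˡ v∈)) refl

        -- A vertex `w` that can take the place of `v`: `N v ∩ U` with `w` added is a (k+1)-clique
        -- that outlives the deletion of `v`.
        Apex : V → Set
        Apex w = w ∈ U × w ∉ star U v × N v ∩ U ⊆ N w

        adjacent⇒apex : ∀ {P} → TopClique U P → star U v ≢ P → ∣ star U v ∩ P ∣ ≡ k → ∃ Apex
        adjacent⇒apex {P} tP@(P⊆U , clP , _) ≢P eq
          with ⊈⇒∃ P (star U v) (λ P⊆ → ≢P (≡-sym (TopClique-≡ tP star-top P⊆)))
        ... | w , w∈P , w∉ = w , P⊆U w∈P , w∉ , λ {x} x∈C →
          ∈N⁺ (clP w x w∈P (C⊆Q (λ v∈P → ≢P (≡-sym (∋v⇒≡star tP v∈P))) eq x∈C) (λ { refl → w∉ (p⊆p∪⁅x⁆ x∈C) }))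

        apex : ¬ U ⊆ star U v → ∃ Apex
        -- The search is decidable, which permits arguing by contradiction. By connectedness an edge
        -- from `p` to `q` leaves the star; its extension `D` is another top clique meeting the
        -- star, a valid start for `no-adjacent⇒⊥`.
        apex U⊈ = decidable-stable (any? λ w → w ∈? U ×-dec ¬? (w ∈? star U v) ×-dec N v ∩ U ⊆? N w) λ none →
          let u , u∈U , u∉ = ⊈⇒∃ U (star U v) U⊈
              p , q , e , p∈ , q∉ , p∈U , q∈U = Conn-cross (star U v) (conn v∈U u∈U) x∈p∪⁅x⁆ u∉
              D , ⊆D , tD = ext {⁅ p ⁆ ∪ ⁅ q ⁆}
                (∪⁅⁆-⊆ (λ x∈ → subst (_∈ U) (≡-sym (x∈⁅y⁆⇒x≡y p x∈)) p∈U) q∈U)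
                (clique-∪⁅⁆ (clique-⁅⁆ p) (λ x∈ → subst (λ x → Adj G x q) (≡-sym (x∈⁅y⁆⇒x≡y p x∈)) e))
          in no-adjacent⇒⊥ ext sa star-top (λ tP ≢P eq → none (adjacent⇒apex tP ≢P eq)) tD
               (λ eq → q∉ (subst (q ∈_) (≡-sym eq) (⊆D x∈p∪⁅x⁆))) (p , ∈∩ p∈ (⊆D (p⊆p∪⁅x⁆ (x∈⁅x⁆ p)))) (<-wellFounded _)

        ext′ : ∃ Apex → Extensible (U - v)
        ext′ (w , w∈U , w∉ , C⊆Nw) {Q} Q⊆ clQ with ext (λ x∈Q → x∈p-y⇒x∈p (Q⊆ x∈Q)) clQ
        ... | D , Q⊆D , tD@(D⊆U , clD , _) with v ∈? D
        ...   | no v∉D = D , Q⊆D , TopClique-remove tD v∉D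
        -- Only a clique whose extension uses `v` needs a new one. It lies in `N v ∩ U`, to which
        -- `w` is added in place of `v`.
        ...   | yes v∈D = (N v ∩ U) ∪ ⁅ w ⁆ , (λ x∈Q → p⊆p∪⁅x⁆ (Q⊆C x∈Q)) ,
          ∪⁅⁆-⊆ (⊆-remove ∈∩ʳ v∉C) (x∈p∧x≢y⇒x∈p-y w∈U (λ { refl → w∉ x∈p∪⁅x⁆ })) ,
          clique-∪⁅⁆ cl (λ x∈C → Adj-sym (∈N⁻ (C⊆Nw x∈C))) ,
          trans (∣p∪⁅x⁆∣ (λ w∈C → w∉ (p⊆p∪⁅x⁆ w∈C))) (cong suc ∣C∣)
          where
          Q⊆C : Q ⊆ N v ∩ U
          Q⊆C x∈Q with x∈p∪⁅y⁆⁻ (clique-⊆-star D⊆U clD v∈D (Q⊆D x∈Q))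
          ... | inj₁ x∈C = x∈C
          ... | inj₂ refl = ⊥-elim (x∈p-y⇒x≢y (Q⊆ x∈Q) refl)

        TopClique-insert : ∀ {Q} → TopClique (U - v) Q → v ∉ Q × TopClique U Q
        TopClique-insert (Q⊆ , rest) = (λ v∈Q → x∈p-y⇒x≢y (Q⊆ v∈Q) refl) , (λ x∈Q → x∈p-y⇒x∈p (Q⊆ x∈Q)) , rest

        sa′ : SepAdjacent (U - v)
        sa′ tQ tQ′ Q≢Q′ ne sep with TopClique-insert tQ | TopClique-insert tQ′
        ... | v∉Q , t | v∉Q′ , t′ = sa t t′ Q≢Q′ ne (Sep-insert cl v∉Q v∉Q′ sep)

        conn′ : ∀ {a b} → a ∈ U - v → b ∈ U - v → Conn (_∈ U - v) a b
        conn′ a∈ b∈ = Conn-map (λ { (x∈U , x≢v) → x∈p∧x≢y⇒x∈p-y x∈U x≢v })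
          (Conn-bypass (λ x∈U y∈U vx vy → cl _ _ (∈∩ (∈N⁺ vx) x∈U) (∈∩ (∈N⁺ vy) y∈U))
            (x∈p-y⇒x≢y a∈) (x∈p-y⇒x≢y b∈) (conn (x∈p-y⇒x∈p a∈) (x∈p-y⇒x∈p b∈)))

        by-cases : Dec (U ⊆ star U v) → Elim U
        by-cases (yes U⊆) with star-top
        ... | ⊆U , clS , ∣S∣ = done (clique-⊆ U⊆ clS) (trans (cong ∣_∣ (⊆-antisym U⊆ ⊆U)) ∣S∣)
        by-cases (no U⊈) = remove v v∈U cl ∣C∣
          (Elim-build (U - v) (rec (x∈p⇒∣p-x∣<∣p∣ v∈U)) (ext′ (apex U⊈)) sa′ conn′)

    -- Elimination orders and k-trees

    -- Carrying the k-tree by an injection `f` onto `U` lets the induction go through: the newest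
    -- vertex is `zero`, so `f zero` is removed first and `f ∘ suc` maps onto the rest.
    KTreeR⇒Elim : ∀ {m E′} → KTreeR k m E′ → (f : Fin m → V) → (∀ {i j} → f i ≡ f j → i ≡ j) →
                  (∀ i j → E G (f i) (f j) ≡ E′ i j) → (U : Subset (n G)) →
                  (∀ i → f i ∈ U) → (∀ {x} → x ∈ U → ∃ λ i → f i ≡ x) → Elim U
    KTreeR⇒Elim base f inj iso U into onto = done clique
      (trans (∣image∣ f inj ⊤ U (λ {i} _ → into i) (λ x∈ → let i , eq = onto x∈ in i , ∈⊤ , eq)) (∣⊤∣≡n (suc k)))
      where
      complete-T : ∀ {m} (i j : Fin m) → i ≢ j → T (complete m i j)
      complete-T i j i≢j with i ≟ j
      ... | yes eq = ⊥-elim (i≢j eq)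
      ... | no _ = _
      clique : IsClique G U
      clique x y x∈ y∈ x≢y with onto x∈ | onto y∈
      ... | i , refl | j , refl = subst T (≡-sym (iso i j)) (complete-T i j (λ { refl → x≢y refl }))
    KTreeR⇒Elim (step {E = E′} t C clC ∣C∣) f inj iso U into onto =
      remove (f zero) (into zero) clique
        (trans (∣image∣ (f ∘ suc) suc-inj C (N (f zero) ∩ U)
                 (λ {i} i∈C → ∈∩ (∈N⁺ (subst T (≡-sym (iso zero (suc i))) (∈⇒T i∈C))) (into (suc i))) in-C) ∣C∣)
        (KTreeR⇒Elim t (f ∘ suc) suc-inj (λ i j → iso (suc i) (suc j)) (U - f zero)
          (λ i → x∈p∧x≢y⇒x∈p-y (into (suc i)) (λ eq → case inj eq of λ ()))
          (λ x∈ → case onto (x∈p-y⇒x∈p x∈) of λ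
            { (zero , eq) → ⊥-elim (x∈p-y⇒x≢y x∈ (≡-sym eq)) ; (suc i , eq) → i , eq }))
      where
      suc-inj : ∀ {i j} → f (suc i) ≡ f (suc j) → i ≡ j
      suc-inj = Fin-suc-injective ∘ inj
      in-C : ∀ {x} → x ∈ N (f zero) ∩ U → ∃ λ i → i ∈ C × f (suc i) ≡ x
      in-C x∈ with onto (∈∩ʳ x∈)
      ... | zero , refl = ⊥-elim (Adj⇒≢ (∈N⁻ (∈∩ˡ x∈)) refl)
      ... | suc i , refl = i , T⇒∈ (subst T (iso zero (suc i)) (∈N⁻ (∈∩ˡ x∈))) , refl
      clique : IsClique G (N (f zero) ∩ U)
      clique x y x∈ y∈ x≢y with in-C x∈ | in-C y∈
      ... | i , i∈C , refl | j , j∈C , refl =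
        subst T (≡-sym (iso (suc i) (suc j))) (clC i j i∈C j∈C (λ { refl → x≢y refl }))

    -- The number of vertices `m` is left existential, which spares a transport along subset sizes
    -- at each removal; it is identified by counting afterwards.
    Elim⇒KTreeR : ∀ {U} → Elim U → ∃ λ m → Σ (Rel m) λ E′ → KTreeR k m E′ × Σ (Fin m → V) λ f →
                  (∀ {i j} → f i ≡ f j → i ≡ j) × (∀ i j → E G (f i) (f j) ≡ E′ i j) ×
                  (∀ i → f i ∈ U) × (∀ {x} → x ∈ U → ∃ λ i → f i ≡ x)
    Elim⇒KTreeR {U} (done cl ∣U∣) with subst (λ m → Σ (Fin m → V) λ f →
      (∀ {i j} → f i ≡ f j → i ≡ j) × (∀ i → f i ∈ U) × (∀ {x} → x ∈ U → ∃ λ i → f i ≡ x)) ∣U∣ (enumerate U)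
    ... | f , inj , into , onto = suc k , complete (suc k) , base , f , inj , iso , into , onto
      where
      iso : ∀ i j → E G (f i) (f j) ≡ complete (suc k) i j
      iso i j with i ≟ j
      ... | yes refl = irrefl G (f i)
      ... | no i≢j = Equivalence.to T-≡ (cl (f i) (f j) (into i) (into j) (i≢j ∘ inj))
    Elim⇒KTreeR {U} (remove v v∈U cl ∣C∣ el) with Elim⇒KTreeR el
    ... | m , E′ , t , f , inj , iso , into , onto =
      suc m , extend E′ C , step t C clC ∣C∣′ , g , g-inj , g-iso , g-into , g-onto
      where
      C = ⟦ (λ i → Adj? v (f i)) ⟧
      f-C : ∀ {i} → i ∈ C → f i ∈ N v ∩ U
      f-C {i} i∈C = ∈∩ (∈N⁺ (∈⟦⟧⁻ (λ i → Adj? v (f i)) i∈C)) (x∈p-y⇒x∈p (into i))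
      f-onto : ∀ {x} → x ∈ N v ∩ U → ∃ λ i → i ∈ C × f i ≡ x
      f-onto x∈ with onto (x∈p∧x≢y⇒x∈p-y (∈∩ʳ x∈) (Adj⇒≢ (Adj-sym (∈N⁻ (∈∩ˡ x∈)))))
      ... | i , refl = i , ∈⟦⟧⁺ (λ i → Adj? v (f i)) (∈N⁻ (∈∩ˡ x∈)) , refl
      ∣C∣′ : ∣ C ∣ ≡ k
      ∣C∣′ = trans (≡-sym (∣image∣ f inj C (N v ∩ U) f-C f-onto)) ∣C∣
      clC : IsCliqueR E′ C
      clC i j i∈C j∈C i≢j = subst T (iso i j) (cl (f i) (f j) (f-C i∈C) (f-C j∈C) (i≢j ∘ inj))
      g : Fin (suc m) → V
      g zero = v
      g (suc i) = f i
      g-inj : ∀ {i j} → g i ≡ g j → i ≡ j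
      g-inj {zero} {zero} _ = refl
      g-inj {zero} {suc j} eq = ⊥-elim (x∈p-y⇒x≢y (into j) (≡-sym eq))
      g-inj {suc i} {zero} eq = ⊥-elim (x∈p-y⇒x≢y (into i) eq)
      g-inj {suc i} {suc j} eq = cong suc (inj eq)
      g-iso : ∀ i j → E G (g i) (g j) ≡ extend E′ C i j
      g-iso zero zero = irrefl G v
      g-iso zero (suc j) = ≡-sym (lookup∘tabulate _ j)
      g-iso (suc i) zero = trans (sym G (f i) v) (≡-sym (lookup∘tabulate _ i))
      g-iso (suc i) (suc j) = iso i j
      g-into : ∀ i → g i ∈ U
      g-into zero = v∈U
      g-into (suc i) = x∈p-y⇒x∈p (into i)
      g-onto : ∀ {x} → x ∈ U → ∃ λ i → g i ≡ x
      g-onto {x} x∈U with x ≟ v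
      ... | yes refl = zero , refl
      ... | no x≢v with onto (x∈p∧x≢y⇒x∈p-y x∈U x≢v)
      ...   | i , eq = suc i , eq

    IsKTree⇒Elim : IsKTree k G → Elim ⊤
    IsKTree⇒Elim (E′ , t , σ , iso) =
      KTreeR⇒Elim t from (λ {i} {j} eq → trans (≡-sym (strictlyInverseˡ i)) (trans (cong to eq) (strictlyInverseˡ j)))
        (λ i j → trans (iso (from i) (from j)) (cong₂ E′ (strictlyInverseˡ i) (strictlyInverseˡ j)))
        ⊤ (λ _ → ∈⊤) (λ {x} _ → to x , strictlyInverseʳ x)
      where open Inverse σ

    Elim⇒IsKTree : Elim ⊤ → IsKTree k G
    Elim⇒IsKTree el with Elim⇒KTreeR el
    -- Here `f` is a bijection onto all vertices, so `m` equals `n G`, and matching on this makes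
    -- `E′` a relation on the vertices of `G`.
    ... | m , E′ , t , f , inj , iso , into , onto with n≡m
      where
      n≡m : n G ≡ m
      n≡m = trans (≡-sym (∣⊤∣≡n (n G))) (trans
        (∣image∣ f inj ⊤ ⊤ (λ _ → ∈⊤) (λ x∈ → proj₁ (onto x∈) , ∈⊤ , proj₂ (onto x∈))) (∣⊤∣≡n m))
    ...   | refl = E′ , t , mk↔ₛ′ g f (λ i → inj (proj₂ (onto ∈⊤))) (λ x → proj₂ (onto ∈⊤)) ,
      λ i j → trans (≡-sym (cong₂ (E G) (proj₂ (onto ∈⊤)) (proj₂ (onto ∈⊤)))) (iso (g i) (g j))
      where
      g : V → V
      g x = proj₁ (onto {x} ∈⊤)

    -- Comparing the reduced clique graph with the line graph

    Elim⇒CrEqualsLine : 1 ≤ k → Elim ⊤ → CrEqualsLine (suc k) G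
    Elim⇒CrEqualsLine 1≤k el = (λ S → mk⇔ max⇒top top⇒max) , λ S S′ → mk⇔ to from
      where
      max⇒top : ∀ {S} → CrVertex G S → LineVertex (suc k) G S
      max⇒top {S} (clS , max) with Elim⇒Extensible el ⊆⊤ clS
      ... | D , S⊆D , _ , clD , ∣D∣ = clS , trans (cong ∣_∣ (⊆-antisym S⊆D (max D clD S⊆D))) ∣D∣
      top⇒max : ∀ {S} → LineVertex (suc k) G S → CrVertex G S
      top⇒max {S} (clS , ∣S∣) = clS , λ T′ clT S⊆T →
        let D , T⊆D , _ , _ , ∣D∣ = Elim⇒Extensible el ⊆⊤ clT
        in ⊆∧∣∣≥⇒⊇ S⊆T (≤-trans (p⊆q⇒∣p∣≤∣q∣ T⊆D) (≤-reflexive (trans ∣D∣ (≡-sym ∣S∣))))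
      to : ∀ {S S′} → CrEdge G S S′ → LineEdge (suc k) G S S′
      to (mS , mS′ , S≢S′ , sp) = tS , tS′ ,
        Elim⇒SepAdjacent el (⊆⊤ , tS) (⊆⊤ , tS′) S≢S′ (proj₁ sp) (SeparatingPair⇒Sep sp)
        where
        tS = max⇒top mS
        tS′ = max⇒top mS′
      from : ∀ {S S′} → LineEdge (suc k) G S S′ → CrEdge G S S′
      from {S} {S′} (tS , tS′ , eq) = top⇒max tS , top⇒max tS′ ,
        (λ { refl → ∩-self-≢k (⊆⊤ , tS) eq }) ,
        Sep⇒SeparatingPair nonempty-∩ (Elim⇒AdjacentSep el (⊆⊤ , tS) (⊆⊤ , tS′) eq)
        where
        -- This is where `1 ≤ k` enters: sharing k vertices must mean sharing at least one.
        nonempty-∩ : Nonempty (S ∩ S′)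
        nonempty-∩ with nonempty? (S ∩ S′)
        ... | yes ne = ne
        ... | no empty = ⊥-elim (<-irrefl (trans (≡-sym (∣⊥∣≡0 (n G))) (trans (cong ∣_∣ (≡-sym (Empty-unique empty))) eq)) 1≤k)

    -- Growing a clique to a maximal one turns the equality of vertex sets into `Extensible ⊤`; the
    -- edges supply `SepAdjacent ⊤`.
    CrEqualsLine⇒Elim : Connected G → Chordal G → CrEqualsLine (suc k) G → Elim ⊤
    CrEqualsLine⇒Elim connected chordal (vertices , edges) =
      Elim-build chordal ⊤ (<-wellFounded _) ext sa
        (λ {a} {b} _ _ → Walk⇒Conn (connected a b) (All.tabulate λ _ → ∈⊤))
      where
      ext : Extensible ⊤
      ext _ cl with maximal-extension cl (<-wellFounded _)
      ... | D , Q⊆D , max = D , Q⊆D , ⊆⊤ , Equivalence.to (vertices D) max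
      sa : SepAdjacent ⊤
      sa {Q} {Q′} (_ , tQ) (_ , tQ′) Q≢Q′ ne sep = proj₂ (proj₂ (Equivalence.to (edges Q Q′)
        (Equivalence.from (vertices Q) tQ , Equivalence.from (vertices Q′) tQ′ , Q≢Q′ , Sep⇒SeparatingPair ne sep)))

theorem6 : (k : ℕ) → 1 ≤ k → (G : Graph) → Connected G → Chordal G →
    (IsKTree k G ⇔ CrEqualsLine (suc k) G)
theorem6 k 1≤k G connected chordal = mk⇔
  (Elim⇒CrEqualsLine G k 1≤k ∘ IsKTree⇒Elim G k)
  (Elim⇒IsKTree G k ∘ CrEqualsLine⇒Elim G k connected chordal)
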